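{- Let $T$ be a tree with $n\ge 3$ vertices. Then $s^*(T)\le 2n-2-L(T)$. Moreover, this bound holds with equality when $T$ is a star.
   Context: For a tree $T$ and vertex $u$, $L(u)$ denotes the set of leaves adjacent to $u$, and $L(T)=\max\{|L(u)|: u\in V(T)\}$. For a graph $G$ and vertex $v$, $N[v]=\{v\}\cup\{u: uv\in E(G)\}$. For a labeling $f:V(G)\to\{1,2,\dots\}$ let $s^*_f(v)=\sum_{x\in N[v]}f(x)$; the labeling is vertex sum-distinguishing if $s^*_f(u)\ne s^*_f(v)$ whenever $N[u]\ne N[v]$. $s^*(G)$ is the smallest $k$ such that $G$ has a vertex sum-distinguishing labeling with labels in $\{1,\dots,k\}$. -}

module Defs where

open import Data.Nat using (ℕ; zero; suc; _+_; _∸_; _*_; _≤_; _⊔_)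
open import Data.Fin using (Fin; _≟_)
open import Data.Bool using (Bool; true; false; _∨_; _∧_; if_then_else_)
open import Data.List using (List; []; _∷_; _++_; length; map; foldr; allFin)
open import Data.Nat.ListAction using (sum)
open import Data.List.Relation.Unary.Linked using (Linked)
open import Data.List.Relation.Unary.Unique.Propositional using (Unique)
open import Data.Product using (Σ; _×_; ∃; ∃-syntax)
open import Relation.Nullary using (¬_; does)
open import Relation.Binary.PropositionalEquality using (_≡_; _≢_)

record Graph (n : ℕ) : Set where
  field
    adj     : Fin n → Fin n → Bool
    symm    : ∀ u v → adj u v ≡ adj v u
    irrefl  : ∀ v → adj v v ≡ false
open Graph public

Adj : ∀ {n} → Graph n → Fin n → Fin n → Set
Adj G u v = adj G u v ≡ true

data Reach {n} (G : Graph n) : Fin n → Fin n → Set where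
  here : ∀ {v} → Reach G v v
  step : ∀ {u w v} → Adj G u w → Reach G w v → Reach G u v

Connected : ∀ {n} → Graph n → Set
Connected G = ∀ u v → Reach G u v

IsPath : ∀ {n} → Graph n → List (Fin n) → Set
IsPath G xs = Linked (Adj G) xs × Unique xs

-- A cycle: distinct vertices x, m₁ … mₖ (k ≥ 1), z, forming a path, with z adjacent to x
-- (so at least 3 vertices).
HasCycle : ∀ {n} → Graph n → Set
HasCycle {n} G =
  Σ (Fin n) λ x → Σ (Fin n) λ m → Σ (List (Fin n)) λ ms → Σ (Fin n) λ z →
    IsPath G (x ∷ m ∷ ms ++ z ∷ []) × Adj G z x

IsTree : ∀ {n} → Graph n → Set
IsTree G = Connected G × ¬ HasCycle G

count : ∀ {n} → (Fin n → Bool) → ℕ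
count {n} p = sum (map (λ x → if p x then 1 else 0) (allFin n))

degree : ∀ {n} → Graph n → Fin n → ℕ
degree G v = count (adj G v)

isLeaf : ∀ {n} → Graph n → Fin n → Bool
isLeaf G v = does (Data.Nat._≟_ (degree G v) 1)

leafCount : ∀ {n} → Graph n → Fin n → ℕ
leafCount G u = count (λ x → adj G u x ∧ isLeaf G x)

maxLeaves : ∀ {n} → Graph n → ℕ
maxLeaves {n} G = foldr _⊔_ 0 (map (leafCount G) (allFin n))

inN : ∀ {n} → Graph n → Fin n → Fin n → Bool
inN G v x = does (v ≟ x) ∨ adj G v x

SameN : ∀ {n} → Graph n → Fin n → Fin n → Set
SameN G u v = ∀ x → inN G u x ≡ inN G v x

closedSum : ∀ {n} → Graph n → (Fin n → ℕ) → Fin n → ℕ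
closedSum {n} G f v = sum (map (λ x → if inN G v x then f x else 0) (allFin n))

Admits : ∀ {n} → Graph n → ℕ → Set
Admits {n} G k = Σ (Fin n → ℕ) λ f →
  (∀ v → 1 ≤ f v × f v ≤ k) ×
  (∀ u v → ¬ SameN G u v → closedSum G f u ≢ closedSum G f v)

IsSStar : ∀ {n} → Graph n → ℕ → Set
IsSStar G k = Admits G k × (∀ j → Admits G j → k ≤ j)

IsStar : ∀ {n} → Graph n → Set
IsStar {n} G = Σ (Fin n) λ c →
  (∀ x → x ≢ c → Adj G c x) × (∀ x y → x ≢ c → y ≢ c → adj G x y ≡ false)

{-# OPTIONS --safe #-}

-- Greedy labelling. Let u have L leaf neighbours and grow a vertex set S from {u}, one vertex v at a
-- time, the leaves at u coming last. As T is acyclic, v has exactly one neighbour p in S, so its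
-- label completes the closed sums of at most v and p. The sum at v must avoid those of the n − 2
-- vertices other than v and p. The sum at p must avoid those of the n − 1 − L vertices other than p
-- and the leaves at u: these leaves are complete only once p = u, and then their sums are smaller
-- than that of u because their closed neighbourhoods are strictly contained in that of u. Likewise,
-- if v and p are completed together then N[v] = {v, p} is strictly contained in N[p]. So at most
-- 2n − 3 − L labels are forbidden. In a star, the leaves need n − 1 different labels.

module Submission where

open import Defs
open import Data.Nat using (ℕ; _≤_; _∸_; _*_; zero; suc; _+_; _<_; _⊔_; z≤n; s≤s)
open import Data.Nat.Properties
  using ( ≤-refl; ≤-reflexive; ≤-trans; <⇒≢; <⇒≱; n≤1+n; suc-injective; module ≤-Reasoning
        ; +-comm; +-suc; +-identityʳ; +-cancelʳ-≤; +-mono-≤; +-mono-<-≤; +-mono-≤-<; +-monoʳ-≤; m≤n+m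
        ; ∸-+-assoc; ∸-monoˡ-≤; ∸-monoʳ-≤; ∸-cancelʳ-≡; m+n∸n≡m; m+[n∸m]≡n; m≤n+m∸n
        ; ⊔-sel; m≤m⊔n; m≤n⊔m; +-0-commutativeMonoid)
open import Data.Nat.Solver using (module +-*-Solver)
open import Data.Bool using (Bool; true; false; _∨_; _∧_; not; if_then_else_)
open import Data.Bool.Properties using (T?; ∨-zeroʳ; ¬-not; T-≡) renaming (_≟_ to _≟ᵇ_)
open import Data.Fin as Fin using (Fin; _≟_; toℕ; fromℕ<; punchIn)
import Data.Fin.Properties as Fin
open import Data.Fin.Subset using (Subset; _∈_; _∉_; _∪_; ⁅_⁆; _⊃_)
open import Data.Fin.Subset.Properties using (_∈?_; p⊆p∪q; q⊆p∪q; x∈p∪q⁻; x∈⁅x⁆; x∈⁅y⁆⇒x≡y)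
open import Data.Fin.Subset.Induction using (Acc; acc; ⊃-wellFounded)
open import Data.List
  using (List; []; _∷_; _++_; length; map; foldr; allFin; filterᵇ; tabulate; lookup)
open import Data.List.Properties using (map-cong; map-tabulate; length-map; length-++; length-tabulate)
open import Data.List.Membership.Propositional using () renaming (_∈_ to _∈ˡ_; _∉_ to _∉ˡ_)
open import Data.List.Membership.Propositional.Properties
  using (∈-allFin; ∈-map⁺; ∈-filter⁺; ∈-++⁺ˡ; ∈-++⁺ʳ)
open import Data.List.Membership.DecPropositional using () renaming (_∈?_ to mem?)
open import Data.List.Relation.Unary.Any using (here; there; index)
open import Data.List.Relation.Unary.Any.Properties using (lookup-index)
open import Data.List.Relation.Unary.All as All using (All; []; _∷_)
import Data.List.Relation.Unary.All.Properties as All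
open import Data.List.Relation.Unary.AllPairs using ([]; _∷_)
import Data.List.Relation.Unary.AllPairs.Properties as AllPairs
open import Data.List.Relation.Unary.Linked using (Linked; []; [-]; _∷_)
open import Data.Nat.ListAction using (sum)
open import Algebra.Properties.CommutativeMonoid.Sum +-0-commutativeMonoid
  using (∑-distrib-+; sum-cong-≗) renaming (sum to ∑)
open import Data.Product using (_×_; _,_; Σ; ∃-syntax; proj₁; proj₂)
open import Data.Sum using (_⊎_; inj₁; inj₂; [_,_]′)
open import Function using (_∘_; id; Equivalence)
open import Relation.Nullary using (¬_; Dec; yes; no; does; contradiction; ¬?; _×-dec_)
open import Relation.Nullary.Decidable using (dec-true; dec-false; decidable-stable)
open import Relation.Binary.PropositionalEquality

private
  variable
    n : ℕ
    A : Set

true≢false : true ≢ false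
true≢false ()

does-true⁻ : ∀ {P : Set} (d : Dec P) → does d ≡ true → P
does-true⁻ (yes p) _ = p

∨-true⁻ : ∀ a {b} → a ∨ b ≡ true → a ≡ true ⊎ b ≡ true
∨-true⁻ true  _ = inj₁ refl
∨-true⁻ false e = inj₂ e

∧-true⁻ : ∀ a {b} → a ∧ b ≡ true → a ≡ true × b ≡ true
∧-true⁻ true e = refl , e

-- Sums and counts over Fin n

sum-tabulate : (g : Fin n → ℕ) → sum (tabulate g) ≡ ∑ g
sum-tabulate {zero}  g = refl
sum-tabulate {suc n} g = cong (g Fin.zero +_) (sum-tabulate (g ∘ Fin.suc))

sum-allFin : (g : Fin n → ℕ) → sum (map g (allFin n)) ≡ ∑ g
sum-allFin g = trans (cong sum (map-tabulate id g)) (sum-tabulate g)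

∑-mono-≤ : {g h : Fin n → ℕ} → (∀ x → g x ≤ h x) → ∑ g ≤ ∑ h
∑-mono-≤ {zero}  g≤h = z≤n
∑-mono-≤ {suc n} g≤h = +-mono-≤ (g≤h Fin.zero) (∑-mono-≤ (g≤h ∘ Fin.suc))

∑-mono-< : {g h : Fin n → ℕ} → (∀ x → g x ≤ h x) → ∀ z → g z < h z → ∑ g < ∑ h
∑-mono-< g≤h Fin.zero    gz<hz = +-mono-<-≤ gz<hz (∑-mono-≤ (g≤h ∘ Fin.suc))
∑-mono-< g≤h (Fin.suc z) gz<hz = +-mono-≤-< (g≤h Fin.zero) (∑-mono-< (g≤h ∘ Fin.suc) z gz<hz)

∑-zero : ∑ {n} (λ _ → 0) ≡ 0
∑-zero {zero}  = refl
∑-zero {suc n} = ∑-zero {n}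

∑-one : ∑ {n} (λ _ → 1) ≡ n
∑-one {zero}  = refl
∑-one {suc n} = cong suc (∑-one {n})

∑-δ : (v : Fin n) (c : ℕ) → ∑ (λ y → if does (v ≟ y) then c else 0) ≡ c
∑-δ {suc n} Fin.zero    c = trans (cong (c +_) (∑-zero {n})) (+-identityʳ c)
∑-δ {suc n} (Fin.suc v) c = ∑-δ v c

count-∑ : (p : Fin n → Bool) → count p ≡ ∑ (λ x → if p x then 1 else 0)
count-∑ p = sum-allFin (λ x → if p x then 1 else 0)

count-≟ : (v : Fin n) → count (λ x → does (v ≟ x)) ≡ 1
count-≟ v = trans (count-∑ (λ x → does (v ≟ x))) (∑-δ v 1)

indicator-mono : ∀ {a b} → (a ≡ true → b ≡ true) → (if a then 1 else 0) ≤ (if b then 1 else 0)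
indicator-mono {false}         _ = z≤n
indicator-mono {true}  {true}  _ = ≤-refl
indicator-mono {true}  {false} h = contradiction (h refl) λ ()

count-mono : (p q : Fin n → Bool) → (∀ x → p x ≡ true → q x ≡ true) → count p ≤ count q
count-mono p q p⇒q =
  subst₂ _≤_ (sym (count-∑ p)) (sym (count-∑ q)) (∑-mono-≤ λ x → indicator-mono (p⇒q x))

count-∨ : (p q : Fin n → Bool) → (∀ x → p x ≡ true → q x ≢ true) →
  count (λ x → p x ∨ q x) ≡ count p + count q
count-∨ p q disjoint = begin
  count (λ x → p x ∨ q x)             ≡⟨ count-∑ (λ x → p x ∨ q x) ⟩
  ∑ (λ x → if p x ∨ q x then 1 else 0) ≡⟨ sum-cong-≗ pointwise ⟩
  ∑ (λ x → ι (p x) + ι (q x))         ≡⟨ ∑-distrib-+ (ι ∘ p) (ι ∘ q) ⟩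
  ∑ (ι ∘ p) + ∑ (ι ∘ q)               ≡⟨ cong₂ _+_ (count-∑ p) (count-∑ q) ⟨
  count p + count q                   ∎
  where
  open ≡-Reasoning
  ι : Bool → ℕ
  ι b = if b then 1 else 0
  pointwise : ∀ x → ι (p x ∨ q x) ≡ ι (p x) + ι (q x)
  pointwise x with p x in px | q x in qx
  ... | true  | true  = contradiction qx (disjoint x px)
  ... | true  | false = refl
  ... | false | _     = refl

length-filterᵇ : (p : A → Bool) (xs : List A) →
  length (filterᵇ (not ∘ p) xs) + sum (map (λ x → if p x then 1 else 0) xs) ≡ length xs
length-filterᵇ p []       = refl
length-filterᵇ p (x ∷ xs) with p x
... | true  = trans (+-suc _ _) (cong suc (length-filterᵇ p xs))
... | false = cong suc (length-filterᵇ p xs)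

-- The complement is a list rather than a count because the forbidden labels arise by mapping over
-- it.
avoiding : (Fin n → Bool) → List (Fin n)
avoiding {n} p = filterᵇ (not ∘ p) (allFin n)

length-avoiding : (p : Fin n → Bool) → length (avoiding p) + count p ≡ n
length-avoiding {n} p = trans (length-filterᵇ p (allFin n)) (length-tabulate id)

∈-avoiding : (p : Fin n → Bool) (x : Fin n) → p x ≡ false → x ∈ˡ avoiding p
∈-avoiding p x px =
  ∈-filter⁺ (T? ∘ not ∘ p) (∈-allFin x) (Equivalence.from T-≡ (cong not px))

-- Otherwise `p` would dominate the indicator of two different elements, whose count is 2. This is
-- how degree 1 yields a single neighbour.
count≡1⇒≡ : {p : Fin n → Bool} → count p ≡ 1 → ∀ {a b} → p a ≡ true → p b ≡ true → a ≡ b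
count≡1⇒≡ {p = p} one {a} {b} pa pb = decidable-stable (a ≟ b) λ a≢b →
  contradiction (subst₂ _≤_ (two a≢b) one (count-mono _ _ sub)) λ { (s≤s ()) }
  where
  two : a ≢ b → count (λ x → does (a ≟ x) ∨ does (b ≟ x)) ≡ 2
  two a≢b = trans
    (count-∨ _ _ λ x ax bx → contradiction
      (trans (does-true⁻ (a ≟ x) ax) (sym (does-true⁻ (b ≟ x) bx))) a≢b)
    (cong₂ _+_ (count-≟ a) (count-≟ b))
  sub : ∀ x → does (a ≟ x) ∨ does (b ≟ x) ≡ true → p x ≡ true
  sub x e with ∨-true⁻ (does (a ≟ x)) e
  ... | inj₁ ax = subst (λ z → p z ≡ true) (does-true⁻ (a ≟ x) ax) pa
  ... | inj₂ bx = subst (λ z → p z ≡ true) (does-true⁻ (b ≟ x) bx) pb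

-- Pigeonhole: if all of 1, ..., k occurred in `xs`, which has fewer than k positions, two different
-- labels would share a position.
fresh : ∀ {k} (xs : List ℕ) → length xs < k → ∃[ c ] (1 ≤ c × c ≤ k) × c ∉ˡ xs
fresh {k} xs len<k with Fin.any? (λ (i : Fin k) → ¬? (mem? Data.Nat._≟_ (suc (toℕ i)) xs))
... | yes (i , i∉xs) = suc (toℕ i) , (s≤s z≤n , Fin.toℕ<n i) , i∉xs
... | no  none =
  let i , j , i<j , same = Fin.pigeonhole len<k (index ∘ covered)
  in contradiction
       (suc-injective (trans (lookup-index (covered i))
         (trans (cong (lookup xs) same) (sym (lookup-index (covered j))))))
       (<⇒≢ i<j)
  where
  covered : ∀ i → suc (toℕ i) ∈ˡ xs
  covered i = decidable-stable (mem? Data.Nat._≟_ (suc (toℕ i)) xs) λ i∉xs → none (i , i∉xs)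

max-attained : (g : A → ℕ) (a : A) (xs : List A) → ∃[ y ] foldr _⊔_ 0 (map g xs) ≤ g y
max-attained g a []       = a , z≤n
max-attained g a (x ∷ xs) with max-attained g a xs | ⊔-sel (g x) (foldr _⊔_ 0 (map g xs))
... | y , le | inj₁ e = x , ≤-reflexive e
... | y , le | inj₂ e = y , ≤-trans (≤-reflexive e) le

≤-max : (g : A → ℕ) {x : A} {xs : List A} → x ∈ˡ xs → g x ≤ foldr _⊔_ 0 (map g xs)
≤-max g (here refl)  = m≤m⊔n _ _
≤-max g (there x∈xs) = ≤-trans (≤-max g x∈xs) (m≤n⊔m _ _)

update : (Fin n → ℕ) → Fin n → ℕ → Fin n → ℕ
update f v c y = if does (v ≟ y) then c else f y

update-bounds : ∀ {f : Fin n → ℕ} {c k} v → (∀ y → 1 ≤ f y × f y ≤ k) → 1 ≤ c × c ≤ k →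
  ∀ y → 1 ≤ update f v c y × update f v c y ≤ k
update-bounds v fb cb y with v ≟ y
... | yes _ = cb
... | no _  = fb y

-- Closed neighbourhoods and their sums

module _ (T : Graph n) where

  Adj-sym : ∀ {x y} → Adj T x y → Adj T y x
  Adj-sym {x} {y} = trans (symm T y x)

  Adj⇒≢ : ∀ {x y} → Adj T x y → x ≢ y
  Adj⇒≢ {x} xy refl = true≢false (trans (sym xy) (irrefl T x))

  inN-refl : ∀ x → inN T x x ≡ true
  inN-refl x rewrite dec-true (x ≟ x) refl = refl

  inN-adj : ∀ {x y} → Adj T x y → inN T x y ≡ true
  inN-adj {x} {y} xy = trans (cong (does (x ≟ y) ∨_) xy) (∨-zeroʳ _)

  inN⁻ : ∀ {x y} → inN T x y ≡ true → x ≡ y ⊎ Adj T x y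
  inN⁻ {x} {y} e with ∨-true⁻ (does (x ≟ y)) e
  ... | inj₁ xy = inj₁ (does-true⁻ (x ≟ y) xy)
  ... | inj₂ xy = inj₂ xy

  inN-separates : ∀ {x y v} → inN T x v ≡ true → inN T y v ≡ false → x ≢ y
  inN-separates xv yv refl = true≢false (trans (sym xv) yv)

  closedSum-∑ : ∀ f x → closedSum T f x ≡ ∑ (λ y → if inN T x y then f y else 0)
  closedSum-∑ f x = sum-allFin (λ y → if inN T x y then f y else 0)

  -- Positive labels turn a proper inclusion of closed neighbourhoods into a strict inequality, with
  -- `z` witnessing properness. Comparisons settled this way cost no forbidden label.
  closedSum-< : ∀ {f x y z} → (∀ v → 1 ≤ f v) → (∀ w → inN T x w ≡ true → inN T y w ≡ true) →
    inN T x z ≡ false → inN T y z ≡ true → closedSum T f x < closedSum T f y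
  closedSum-< {f} {x} {y} {z} f≥1 sub xz yz =
    subst₂ _<_ (sym (closedSum-∑ f x)) (sym (closedSum-∑ f y))
      (∑-mono-< mono z (strict xz yz))
    where
    term : Fin n → Fin n → ℕ
    term a w = if inN T a w then f w else 0
    mono : ∀ w → term x w ≤ term y w
    mono w with inN T x w in xw
    ... | false = z≤n
    ... | true rewrite sub w xw = ≤-refl
    strict : inN T x z ≡ false → inN T y z ≡ true → term x z < term y z
    strict e e′ rewrite e | e′ = f≥1 z

  closedSum-update-∉ : ∀ f v c x → inN T x v ≡ false → closedSum T (update f v c) x ≡ closedSum T f x
  closedSum-update-∉ f v c x xv =
    trans (closedSum-∑ (update f v c) x) (trans (sum-cong-≗ same) (sym (closedSum-∑ f x)))
    where
    same : ∀ y → (if inN T x y then update f v c y else 0) ≡ (if inN T x y then f y else 0)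
    same y with inN T x y in xy | v ≟ y
    ... | false | _        = refl
    ... | true  | no _     = refl
    ... | true  | yes refl = contradiction (trans (sym xy) xv) true≢false

  -- The value 0 is not a legal label; it isolates the contribution of the vertices other than `v`,
  -- which does not depend on `c`.
  closedSum-update-∈ : ∀ f v c x → inN T x v ≡ true →
    closedSum T (update f v c) x ≡ c + closedSum T (update f v 0) x
  closedSum-update-∈ f v c x xv = begin
    closedSum T (update f v c) x ≡⟨ closedSum-∑ (update f v c) x ⟩
    ∑ (term c)                   ≡⟨ sum-cong-≗ split ⟩
    ∑ (λ y → δ y + term 0 y)     ≡⟨ ∑-distrib-+ δ (term 0) ⟩
    ∑ δ + ∑ (term 0)             ≡⟨ cong₂ _+_ (∑-δ v c) (sym (closedSum-∑ (update f v 0) x)) ⟩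
    c + closedSum T (update f v 0) x ∎
    where
    open ≡-Reasoning
    δ : Fin n → ℕ
    δ y = if does (v ≟ y) then c else 0
    term : ℕ → Fin n → ℕ
    term d y = if inN T x y then update f v d y else 0
    split : ∀ y → term c y ≡ δ y + term 0 y
    split y with inN T x y in xy | v ≟ y
    ... | true  | yes _    = sym (+-identityʳ c)
    ... | true  | no _     = refl
    ... | false | no _     = refl
    ... | false | yes refl = contradiction (trans (sym xv) xy) true≢false

  isLeafAt : Fin n → Fin n → Bool
  isLeafAt u x = adj T u x ∧ isLeaf T x

  leaf-adj : ∀ {u x} → isLeafAt u x ≡ true → Adj T u x
  leaf-adj {u} {x} ux = proj₁ (∧-true⁻ (adj T u x) ux)

  leaf-neighbour : ∀ {u x y} → isLeafAt u x ≡ true → Adj T x y → y ≡ u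
  leaf-neighbour {u} {x} ux xy =
    count≡1⇒≡ (does-true⁻ (degree T x Data.Nat.≟ 1) (proj₂ (∧-true⁻ (adj T u x) ux)))
      xy (Adj-sym (leaf-adj ux))

  -- Connectivity and paths inside a vertex set

  reach-closed : (P : Fin n → Set) → (∀ {x y} → P x → Adj T x y → P y) →
    ∀ {x y} → Reach T x y → P x → P y
  reach-closed P closed here        px = px
  reach-closed P closed (step xw r) px = reach-closed P closed r (closed px xw)

  -- The list has the shape used in `HasCycle`, so that prefixing one outside vertex yields the
  -- vertex list of a cycle directly.
  PathJoined : Subset n → Fin n → Fin n → Set
  PathJoined S a b = Σ (List (Fin n)) λ ms →
    IsPath T (a ∷ ms ++ b ∷ []) × All (_∈ S) (a ∷ ms ++ b ∷ [])

  PathConnected : Subset n → Set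
  PathConnected S = ∀ {a b} → a ∈ S → b ∈ S → a ≢ b → PathJoined S a b

  -- Relabelling vertices outside `S` no longer affects the closed sum at such an `x`. As `x` lies
  -- in its own closed neighbourhood, `x ∈ S` follows.
  Final : Subset n → Fin n → Set
  Final S x = ∀ y → inN T x y ≡ true → y ∈ S

Linked-snoc : ∀ {R : A → A → Set} xs {p v} → Linked R (xs ++ p ∷ []) → R p v →
  Linked R ((xs ++ p ∷ []) ++ v ∷ [])
Linked-snoc []           _         Rpv = Rpv ∷ [-]
Linked-snoc (x ∷ [])     (Rxp ∷ _) Rpv = Rxp ∷ Rpv ∷ [-]
Linked-snoc (x ∷ y ∷ xs) (Rxy ∷ l) Rpv = Rxy ∷ Linked-snoc (y ∷ xs) l Rpv

∈-snoc⁻ : ∀ {S : Subset n} {v x} → x ∈ S ∪ ⁅ v ⁆ → x ∈ S ⊎ x ≡ v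
∈-snoc⁻ {S = S} {v} x∈ with x∈p∪q⁻ S ⁅ v ⁆ x∈
... | inj₁ x∈S = inj₁ x∈S
... | inj₂ x∈v = inj₂ (x∈⁅y⁆⇒x≡y v x∈v)

module _ (T : Graph n) where

  -- A path ending at `p` is prolonged by the edge to `v`, and `v ∉ S` keeps its vertices distinct.
  -- The endpoint `p` is a separate case because paths are supplied only between different vertices.
  PathConnected-snoc : ∀ {S p v} → PathConnected T S → p ∈ S → v ∉ S → Adj T p v →
    PathConnected T (S ∪ ⁅ v ⁆)
  PathConnected-snoc {S} {p} {v} conn p∈S v∉S pv {a} {b} a∈ b∈ a≢b
    with ∈-snoc⁻ {S = S} a∈ | ∈-snoc⁻ {S = S} b∈
  ... | inj₂ refl | inj₂ refl = contradiction refl a≢b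
  ... | inj₁ a∈S  | inj₁ b∈S  =
    let ms , path , ms⊆S = conn a∈S b∈S a≢b in ms , path , All.map (p⊆p∪q ⁅ v ⁆) ms⊆S
  ... | inj₂ refl | inj₁ b∈S with b ≟ p
  ...   | yes refl = [] , (Adj-sym T pv ∷ [-] , (a≢b ∷ []) ∷ [] ∷ []) , a∈ ∷ b∈ ∷ []
  ...   | no b≢p =
    let ms , (linked , uniq) , ms⊆S = conn p∈S b∈S (b≢p ∘ sym)
    in p ∷ ms
     , (Adj-sym T pv ∷ linked , All.map (λ { x∈S refl → v∉S x∈S }) ms⊆S ∷ uniq)
     , a∈ ∷ All.map (p⊆p∪q ⁅ v ⁆) ms⊆S
  PathConnected-snoc {S} {p} {v} conn p∈S v∉S pv {a} {b} a∈ b∈ a≢b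
      | inj₁ a∈S  | inj₂ refl with a ≟ p
  ...   | yes refl = [] , (pv ∷ [-] , (a≢b ∷ []) ∷ [] ∷ []) , a∈ ∷ b∈ ∷ []
  ...   | no a≢p =
    let ms , (linked , uniq) , ms⊆S = conn a∈S p∈S a≢p
    in ms ++ p ∷ []
     , (Linked-snoc (a ∷ ms) linked pv
       , AllPairs.++⁺ uniq ([] ∷ []) (All.map (λ { x∈S → (λ { refl → v∉S x∈S }) ∷ [] }) ms⊆S))
     , All.++⁺ (All.map (p⊆p∪q ⁅ v ⁆) ms⊆S) (b∈ ∷ [])

  -- Two different attachment points would be joined by a path inside `S`, and `v`, lying outside
  -- `S`, would close it to a cycle.
  attachment-unique : ∀ {S p q v} → ¬ HasCycle T → PathConnected T S → v ∉ S →
    p ∈ S → Adj T v p → q ∈ S → Adj T v q → q ≡ p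
  attachment-unique {S} {p} {q} {v} acyclic conn v∉S p∈S vp q∈S vq =
    decidable-stable (q ≟ p) λ q≢p →
      let ms , (linked , uniq) , ms⊆S = conn p∈S q∈S (q≢p ∘ sym)
      in acyclic
        ( v , p , ms , q
        , (vp ∷ linked , All.map (λ { x∈S refl → v∉S x∈S }) ms⊆S ∷ uniq)
        , Adj-sym T vq)

  -- Otherwise `v` and `p` would form a set closed under adjacency, hence the whole connected graph,
  -- and `side` would inject `Fin n` into `Fin 2`.
  another-neighbour : 3 ≤ n → Connected T → ∀ {p v} → (∀ w → inN T v w ≡ true → w ≡ v ⊎ w ≡ p) →
    ∃[ z ] Adj T p z × z ≢ v
  another-neighbour 3≤n conn {p} {v} Nv with Fin.any? (λ z → (adj T p z ≟ᵇ true) ×-dec ¬? (z ≟ v))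
  ... | yes found = found
  ... | no  none  = contradiction (Fin.injective⇒≤ side-injective) (<⇒≱ 3≤n)
    where
    closed : ∀ {x y} → x ≡ v ⊎ x ≡ p → Adj T x y → y ≡ v ⊎ y ≡ p
    closed (inj₁ refl) xy = Nv _ (inN-adj T xy)
    closed {y = y} (inj₂ refl) xy = inj₁ (decidable-stable (y ≟ v) λ y≢v → none (y , xy , y≢v))
    all : ∀ w → w ≡ v ⊎ w ≡ p
    all w = reach-closed T (λ x → x ≡ v ⊎ x ≡ p) closed (conn v w) (inj₁ refl)
    side : Fin n → Fin 2
    side w with all w
    ... | inj₁ _ = Fin.zero
    ... | inj₂ _ = Fin.suc Fin.zero
    side-injective : ∀ {x y} → side x ≡ side y → x ≡ y
    side-injective {x} {y} e with all x | all y
    ... | inj₁ refl | inj₁ refl = refl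
    ... | inj₂ refl | inj₂ refl = refl

-- Greedy labelling from a root `u`

module Greedy (T : Graph n) (3≤n : 3 ≤ n) (connected : Connected T) (acyclic : ¬ HasCycle T)
  -- `room` is the additive form of k ≥ 2n - 2 - L, free of truncated subtraction.
  (u : Fin n) (k : ℕ) (room : 2 * n ≤ k + (2 + leafCount T u)) where

  -- `f` is total, so its values outside `S` are placeholders and only final vertices are compared.
  -- The separation is stronger than in `Admits`: it concerns different vertices, not merely
  -- different closed neighbourhoods.
  Labelling : Subset n → Set
  Labelling S = Σ (Fin n → ℕ) λ f →
    (∀ v → 1 ≤ f v × f v ≤ k) ×
    (∀ {x y} → Final T S x → Final T S y → x ≢ y → closedSum T f x ≢ closedSum T f y)

  -- These are left out of the comparisons with `p`: besides `p` itself, the leaves at `u`, which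
  -- are either not yet final or have a smaller sum than `p`.
  isExempt : Fin n → Fin n → Bool
  isExempt p x = isLeafAt T u x ∨ does (p ≟ x)

  count-exempt : ∀ {p} → isLeafAt T u p ≢ true → count (isExempt p) ≡ leafCount T u + 1
  count-exempt {p} ¬up = trans
    (count-∨ _ _ λ x ux px →
      ¬up (subst (λ z → isLeafAt T u z ≡ true) (sym (does-true⁻ (p ≟ x) px)) ux))
    (cong (leafCount T u +_) (count-≟ p))

  length-nonexempt : ∀ {p} → isLeafAt T u p ≢ true →
    length (avoiding (isExempt p)) + (leafCount T u + 1) ≡ n
  length-nonexempt {p} ¬up =
    trans (cong (length (avoiding (isExempt p)) +_) (sym (count-exempt ¬up)))
      (length-avoiding (isExempt p))

  -- The initial labelling by 1 requires this. The vertex `u` and its leaves are L + 1 ≤ n different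
  -- vertices, so `room` gives k ≥ n - 1 after cancelling 2 + L.
  1≤k : 1 ≤ k
  1≤k = ≤-trans (≤-trans (n≤1+n 1) (∸-monoˡ-≤ 1 3≤n)) (+-cancelʳ-≤ (2 + L) _ _ (begin
    n ∸ 1 + (2 + L)     ≡⟨ shift n 3≤n ⟩
    n + (1 + L)         ≡⟨ cong (n +_) (+-comm 1 L) ⟩
    n + (L + 1)         ≤⟨ +-monoʳ-≤ n (m≤n+m (L + 1) (length (avoiding (isExempt u)))) ⟩
    n + (length (avoiding (isExempt u)) + (L + 1)) ≡⟨ cong (n +_) (length-nonexempt u-not-leaf) ⟩
    n + n               ≡⟨ cong (n +_) (+-identityʳ n) ⟨
    2 * n               ≤⟨ room ⟩
    k + (2 + L)         ∎))
    where
    open ≤-Reasoning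
    L = leafCount T u
    u-not-leaf : isLeafAt T u u ≢ true
    u-not-leaf uu = Adj⇒≢ T (leaf-adj T uu) refl
    shift : ∀ n → 3 ≤ n → n ∸ 1 + (2 + L) ≡ n + (1 + L)
    shift (suc n) _ = +-suc n (1 + L)

  -- `order` encodes that the leaves at `u` come last: as long as `p` differs from `u`, no such leaf
  -- is in `S`. Either alternative keeps `p` from being a leaf at `u`.
  module Extend {S : Subset n} {p v : Fin n} (v∉S : v ∉ S) (p∈S : p ∈ S) (pv : Adj T p v)
    (unique : ∀ {q} → q ∈ S → Adj T v q → q ≡ p)
    (order : (∀ x → isLeafAt T u x ≡ true → x ∉ S) ⊎ p ≡ u)
    (f : Fin n → ℕ) where

    p-not-leaf : isLeafAt T u p ≢ true
    p-not-leaf up = [ (λ none → none p up p∈S) , (λ { refl → Adj⇒≢ T (leaf-adj T up) refl }) ]′ order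

    isEndpoint : Fin n → Bool
    isEndpoint x = does (v ≟ x) ∨ does (p ≟ x)

    count-endpoints : count isEndpoint ≡ 2
    count-endpoints = trans
      (count-∨ _ _ λ x vx px → contradiction
        (trans (does-true⁻ (p ≟ x) px) (sym (does-true⁻ (v ≟ x) vx))) (Adj⇒≢ T pv))
      (cong₂ _+_ (count-≟ v) (count-≟ p))

    -- The label of v that would give x the sum currently held by y.
    clash : Fin n → Fin n → ℕ
    clash x y = closedSum T f y ∸ closedSum T (update f v 0) x

    forbidden : List ℕ
    forbidden = map (clash v) (avoiding isEndpoint) ++ map (clash p) (avoiding (isExempt p))

    forbidden-length : length forbidden < k
    forbidden-length = +-cancelʳ-≤ (2 + L) _ _ (begin
      -- Since a + 2 = n and b + L + 1 = n, the list has 2n - 3 - L entries; the `suc` of the strict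
      -- inequality supplies the missing unit.
      suc (length forbidden) + (2 + L)  ≡⟨ cong (λ l → suc l + (2 + L)) length-split ⟩
      suc (a + b) + (2 + L)             ≡⟨ rearrange a b L ⟩
      (a + 2) + (b + (L + 1))           ≡⟨ cong₂ _+_ length-nonendpoints (length-nonexempt p-not-leaf) ⟩
      n + n                             ≡⟨ cong (n +_) (+-identityʳ n) ⟨
      2 * n                             ≤⟨ room ⟩
      k + (2 + L)                       ∎)
      where
      open ≤-Reasoning
      L = leafCount T u
      a = length (avoiding isEndpoint)
      b = length (avoiding (isExempt p))
      length-split : length forbidden ≡ a + b
      length-split = trans (length-++ (map (clash v) (avoiding isEndpoint)))
        (cong₂ _+_ (length-map _ (avoiding isEndpoint)) (length-map _ (avoiding (isExempt p))))
      length-nonendpoints : a + 2 ≡ n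
      length-nonendpoints = trans (cong (a +_) (sym count-endpoints)) (length-avoiding isEndpoint)
      rearrange : ∀ a b l → suc (a + b) + (2 + l) ≡ (a + 2) + (b + (l + 1))
      rearrange = solve 3 (λ a b l → (con 1 :+ (a :+ b)) :+ (con 2 :+ l) :=
        (a :+ con 2) :+ (b :+ (l :+ con 1))) refl
        where open +-*-Solver

    v∈N[p] : inN T p v ≡ true
    v∈N[p] = inN-adj T pv

    Final-restrict : ∀ {x} → Final T (S ∪ ⁅ v ⁆) x → inN T x v ≡ false → Final T S x
    Final-restrict {x} fin xv y xy with ∈-snoc⁻ {S = S} (fin y xy)
    ... | inj₁ y∈S  = y∈S
    ... | inj₂ refl = contradiction (trans (sym xy) xv) true≢false

    -- A final `x` itself lies in `S ∪ ⁅ v ⁆`; if it is adjacent to `v`, it lies in `S`, and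
    -- `unique` makes it `p`.
    newly-final : ∀ {x} → Final T (S ∪ ⁅ v ⁆) x → inN T x v ≡ true → x ≡ v ⊎ x ≡ p
    newly-final {x} fin xv with inN⁻ T xv | ∈-snoc⁻ {S = S} (fin x (inN-refl T x))
    ... | inj₁ x≡v | _        = inj₁ x≡v
    ... | inj₂ _   | inj₂ x≡v = inj₁ x≡v
    ... | inj₂ xv′ | inj₁ x∈S = inj₂ (unique x∈S (Adj-sym T xv′))

    module _ (c : ℕ) (c∉ : c ∉ˡ forbidden) (bounds : ∀ y → 1 ≤ update f v c y) where

      private
        g = update f v c

      -- Only the sum at `x` involves `c`, so equality would mean that `c` plus the rest at `x` is
      -- the old sum at `y`. The truncated subtraction in `clash x y` is then exact and returns `c`.
      avoids : ∀ {x y} → inN T x v ≡ true → inN T y v ≡ false → clash x y ∈ˡ forbidden →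
        closedSum T g x ≢ closedSum T g y
      avoids {x} {y} xv yv clash∈ e = c∉ (subst (_∈ˡ forbidden) (sym c≡clash) clash∈)
        where
        rest = closedSum T (update f v 0) x
        c≡clash : c ≡ clash x y
        c≡clash = trans (sym (m+n∸n≡m c rest)) (cong (_∸ rest)
          (trans (sym (closedSum-update-∈ T f v c x xv)) (trans e (closedSum-update-∉ T f v c y yv))))

      -- Finality of `v` confines its closed neighbourhood to `v` and `p`, and `another-neighbour`
      -- supplies a neighbour of `p` outside it.
      v<p : Final T (S ∪ ⁅ v ⁆) v → closedSum T g v < closedSum T g p
      v<p fin =
        let z , pz , z≢v = another-neighbour T 3≤n connected {p} N[v]
        in closedSum-< T bounds
             (λ w vw → case-N w (N[v] w vw))
             (¬-not λ vz → case-z pz z≢v (N[v] z vz))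
             (inN-adj T pz)
        where
        N[v] : ∀ w → inN T v w ≡ true → w ≡ v ⊎ w ≡ p
        N[v] w vw with inN⁻ T vw | ∈-snoc⁻ {S = S} (fin w vw)
        ... | inj₁ refl | _        = inj₁ refl
        ... | inj₂ _    | inj₂ w≡v = inj₁ w≡v
        ... | inj₂ vw′  | inj₁ w∈S = inj₂ (unique w∈S vw′)
        case-N : ∀ w → w ≡ v ⊎ w ≡ p → inN T p w ≡ true
        case-N w (inj₁ refl) = v∈N[p]
        case-N w (inj₂ refl) = inN-refl T p
        case-z : ∀ {z} → Adj T p z → z ≢ v → ¬ (z ≡ v ⊎ z ≡ p)
        case-z pz z≢v (inj₁ e)    = z≢v e
        case-z pz z≢v (inj₂ refl) = Adj⇒≢ T pz refl

      -- The closed neighbourhood of the leaf `y` consists of `y` and `u`. It misses `v`, because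
      -- `y` is in `S`, `v` is not, and `v` differs from its neighbour `u`.
      leaf<u : ∀ {y} → p ≡ u → isLeafAt T u y ≡ true → y ∈ S → closedSum T g y < closedSum T g p
      leaf<u {y} refl uy y∈S = closedSum-< T bounds sub (¬-not not-in) v∈N[p]
        where
        sub : ∀ w → inN T y w ≡ true → inN T p w ≡ true
        sub w yw with inN⁻ T yw
        ... | inj₁ refl = inN-adj T (leaf-adj T uy)
        ... | inj₂ yw′ rewrite leaf-neighbour T uy yw′ = inN-refl T p
        not-in : inN T y v ≢ true
        not-in yv with inN⁻ T yv
        ... | inj₁ refl = v∉S y∈S
        ... | inj₂ yv′  = Adj⇒≢ T pv (sym (leaf-neighbour T uy yv′))

      p≢old : ∀ {y} → Final T S y → inN T y v ≡ false → closedSum T g p ≢ closedSum T g y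
      p≢old {y} fin yv with isLeafAt T u y in uy
      -- A final leaf `y` lies in `S`, which refutes the first alternative of `order` and leaves
      -- `p ≡ u`.
      ... | true  = [ (λ none → contradiction y∈S (none y uy))
                    , (λ p≡u → <⇒≢ (leaf<u p≡u uy y∈S) ∘ sym) ]′ order
        where y∈S = fin y (inN-refl T y)
      ... | false = avoids v∈N[p] yv (∈-++⁺ʳ (map (clash v) (avoiding isEndpoint))
        (∈-map⁺ (clash p) (∈-avoiding (isExempt p) y
          (cong₂ _∨_ uy (dec-false (p ≟ y) (inN-separates T v∈N[p] yv))))))

      v≢old : ∀ {y} → inN T y v ≡ false → closedSum T g v ≢ closedSum T g y
      v≢old {y} yv = avoids (inN-refl T v) yv (∈-++⁺ˡ (∈-map⁺ (clash v) (∈-avoiding isEndpoint y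
        (cong₂ _∨_ (dec-false (v ≟ y) (inN-separates T (inN-refl T v) yv))
                   (dec-false (p ≟ y) (inN-separates T v∈N[p] yv))))))

      new≢old : ∀ {x y} → Final T (S ∪ ⁅ v ⁆) x → Final T (S ∪ ⁅ v ⁆) y →
        inN T x v ≡ true → inN T y v ≡ false → closedSum T g x ≢ closedSum T g y
      new≢old finx finy xv yv with newly-final finx xv
      ... | inj₁ refl = v≢old yv
      ... | inj₂ refl = p≢old (Final-restrict finy yv) yv

      new≢new : ∀ {x y} → Final T (S ∪ ⁅ v ⁆) x → Final T (S ∪ ⁅ v ⁆) y →
        inN T x v ≡ true → inN T y v ≡ true → x ≢ y → closedSum T g x ≢ closedSum T g y
      new≢new finx finy xv yv x≢y with newly-final finx xv | newly-final finy yv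
      ... | inj₁ refl | inj₁ refl = contradiction refl x≢y
      ... | inj₂ refl | inj₂ refl = contradiction refl x≢y
      ... | inj₁ refl | inj₂ refl = <⇒≢ (v<p finx)
      ... | inj₂ refl | inj₁ refl = <⇒≢ (v<p finy) ∘ sym

  extend : ∀ {S p v} → v ∉ S → p ∈ S → Adj T p v → (∀ {q} → q ∈ S → Adj T v q → q ≡ p) →
    ((∀ x → isLeafAt T u x ≡ true → x ∉ S) ⊎ p ≡ u) → Labelling S → Labelling (S ∪ ⁅ v ⁆)
  extend {S} {p} {v} v∉S p∈S pv unique order (f , bounds , distinct)
    with c , c-bounds , c∉ ← fresh (Extend.forbidden v∉S p∈S pv unique order f)
                                   (Extend.forbidden-length v∉S p∈S pv unique order f)
    = update f v c , g-bounds , separated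
    where
    open Extend v∉S p∈S pv unique order f
    g-bounds = update-bounds v bounds c-bounds
    separated : ∀ {x y} → Final T (S ∪ ⁅ v ⁆) x → Final T (S ∪ ⁅ v ⁆) y → x ≢ y →
      closedSum T (update f v c) x ≢ closedSum T (update f v c) y
    separated {x} {y} finx finy x≢y with inN T x v in xv | inN T y v in yv
    ... | true  | true  = new≢new c c∉ (proj₁ ∘ g-bounds) finx finy xv yv x≢y
    ... | true  | false = new≢old c c∉ (proj₁ ∘ g-bounds) finx finy xv yv
    ... | false | true  = new≢old c c∉ (proj₁ ∘ g-bounds) finy finx yv xv ∘ sym
    ... | false | false = λ e → distinct (Final-restrict finx xv) (Final-restrict finy yv) x≢y
      (trans (sym (closedSum-update-∉ T f v c x xv)) (trans e (closedSum-update-∉ T f v c y yv)))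

  -- A walk can only leave S ∪ L(u) from S, since from a leaf at u it returns to u.
  frontier : ∀ {S} → u ∈ S → ∀ {a w} → Reach T a w → a ∈ S ⊎ isLeafAt T u a ≡ true →
    w ∉ S → isLeafAt T u w ≡ false →
    ∃[ p ] ∃[ v ] p ∈ S × v ∉ S × Adj T p v × isLeafAt T u v ≡ false
  frontier u∈S here (inj₁ w∈S) w∉S _  = contradiction w∈S w∉S
  frontier u∈S here (inj₂ uw)  _   ¬uw = contradiction (trans (sym uw) ¬uw) true≢false
  frontier u∈S (step ab r) (inj₂ ua) w∉S ¬uw
    rewrite leaf-neighbour T ua ab = frontier u∈S r (inj₁ u∈S) w∉S ¬uw
  frontier {S} u∈S (step {w = b} ab r) (inj₁ a∈S) w∉S ¬uw with b ∈? S | isLeafAt T u b in ub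
  ... | yes b∈S | _     = frontier u∈S r (inj₁ b∈S) w∉S ¬uw
  ... | no _    | true  = frontier u∈S r (inj₂ ub) w∉S ¬uw
  ... | no b∉S  | false = _ , b , a∈S , b∉S , ab , ub

  -- Growing the labelled set to the whole tree

  Complete : Set
  Complete = ∃[ S ] (∀ x → x ∈ S) × Labelling S

  attach : ∀ {S p v} → PathConnected T S → Labelling S → v ∉ S → p ∈ S → Adj T p v →
    (∀ x → isLeafAt T u x ≡ true → x ∉ S) ⊎ p ≡ u →
    ((S ∪ ⁅ v ⁆) ⊃ S) × PathConnected T (S ∪ ⁅ v ⁆) × Labelling (S ∪ ⁅ v ⁆)
  attach {S} {p} {v} conn lab v∉S p∈S pv order =
    (p⊆p∪q ⁅ v ⁆ , v , q⊆p∪q S ⁅ v ⁆ (x∈⁅x⁆ v) , v∉S) ,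
    PathConnected-snoc T conn p∈S v∉S pv ,
    extend v∉S p∈S pv (attachment-unique T acyclic conn v∉S p∈S (Adj-sym T pv)) order lab

  -- Second phase: all missing vertices are leaves at `u`, so each attaches to `u` and the second
  -- alternative of `order` applies.
  add-leaves : ∀ S → Acc _⊃_ S → u ∈ S → PathConnected T S →
    (∀ x → x ∉ S → isLeafAt T u x ≡ true) → Labelling S → Complete
  add-leaves S (acc rec) u∈S conn leaves lab with Fin.any? (λ v → ¬? (v ∈? S))
  ... | no none = S , (λ x → decidable-stable (x ∈? S) λ x∉S → none (x , x∉S)) , lab
  ... | yes (v , v∉S) =
    let larger , conn′ , lab′ = attach conn lab v∉S u∈S (leaf-adj T (leaves v v∉S)) (inj₂ refl)
    in add-leaves (S ∪ ⁅ v ⁆) (rec larger) (p⊆p∪q ⁅ v ⁆ u∈S) conn′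
         (λ x x∉ → leaves x (x∉ ∘ p⊆p∪q ⁅ v ⁆)) lab′

  -- First phase: only vertices that are not leaves at `u` are attached, which preserves the first
  -- alternative of `order`. When none is left, `add-leaves` takes over.
  grow : ∀ S → Acc _⊃_ S → u ∈ S → PathConnected T S →
    (∀ x → isLeafAt T u x ≡ true → x ∉ S) → Labelling S → Complete
  grow S (acc rec) u∈S conn no-leaves lab
    with Fin.any? (λ v → ¬? (v ∈? S) ×-dec (isLeafAt T u v ≟ᵇ false))
  ... | no none = add-leaves S (acc rec) u∈S conn (λ x x∉S → ¬-not λ ¬ux → none (x , x∉S , ¬ux)) lab
  ... | yes (w , w∉S , ¬uw) =
    let p , v , p∈S , v∉S , pv , ¬uv = frontier u∈S (connected u w) (inj₁ u∈S) w∉S ¬uw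
        larger , conn′ , lab′ = attach conn lab v∉S p∈S pv (inj₁ no-leaves)
    in grow (S ∪ ⁅ v ⁆) (rec larger) (p⊆p∪q ⁅ v ⁆ u∈S) conn′ (no-leaves′ ¬uv) lab′
    where
    no-leaves′ : ∀ {v} → isLeafAt T u v ≡ false → ∀ x → isLeafAt T u x ≡ true → x ∉ S ∪ ⁅ v ⁆
    no-leaves′ ¬uv x ux x∈ with ∈-snoc⁻ {S = S} x∈
    ... | inj₁ x∈S  = no-leaves x ux x∈S
    ... | inj₂ refl = true≢false (trans (sym ux) ¬uv)

  admits : Admits T k
  admits with grow ⁅ u ⁆ (⊃-wellFounded ⁅ u ⁆) (x∈⁅x⁆ u)
      (λ a∈ b∈ a≢b → contradiction (same a∈ b∈) a≢b)
      (λ x ux x∈ → Adj⇒≢ T (leaf-adj T ux) (sym (x∈⁅y⁆⇒x≡y u x∈)))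
      -- A vertex that is final in `⁅ u ⁆` must be `u`, so the constant labelling has no pair to
      -- separate yet.
      ( (λ _ → 1) , (λ _ → ≤-refl , 1≤k)
      , λ finx finy x≢y → contradiction (same (finx _ (inN-refl T _)) (finy _ (inN-refl T _))) x≢y)
    where
    same : ∀ {a b} → a ∈ ⁅ u ⁆ → b ∈ ⁅ u ⁆ → a ≡ b
    same a∈ b∈ = trans (x∈⁅y⁆⇒x≡y u a∈) (sym (x∈⁅y⁆⇒x≡y u b∈))
  ... | S , full , f , bounds , distinct =
    f , bounds , λ x y ¬same → distinct (λ z _ → full z) (λ z _ → full z) λ { refl → ¬same λ _ → refl }

-- Stars

module Star {m : ℕ} (T : Graph (suc m)) (c : Fin (suc m)) (centre : ∀ x → x ≢ c → Adj T c x)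
  (independent : ∀ x y → x ≢ c → y ≢ c → adj T x y ≡ false) where

  adj-leaf : ∀ {x} → x ≢ c → ∀ y → adj T x y ≡ does (c ≟ y)
  adj-leaf {x} x≢c y with c ≟ y
  ... | yes refl = Adj-sym T (centre x x≢c)
  ... | no c≢y   = independent x y x≢c (c≢y ∘ sym)

  count-cong : {p q : Fin (suc m) → Bool} → (∀ x → p x ≡ q x) → count p ≡ count q
  count-cong p≗q = cong sum (map-cong (λ x → cong (if_then 1 else 0) (p≗q x)) (allFin (suc m)))

  leaf-at-centre : ∀ x → x ≢ c → isLeafAt T c x ≡ true
  leaf-at-centre x x≢c = cong₂ _∧_ (centre x x≢c)
    (dec-true (degree T x Data.Nat.≟ 1) (trans (count-cong (adj-leaf x≢c)) (count-≟ c)))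

  -- The leaves at `c` together with `c` cover all m + 1 vertices.
  m≤leafCount : m ≤ leafCount T c
  m≤leafCount = +-cancelʳ-≤ 1 _ _ (begin
    m + 1                                       ≡⟨ +-comm m 1 ⟩
    suc m                                       ≡⟨ ∑-one {suc m} ⟨
    ∑ {suc m} (λ _ → 1)                         ≡⟨ count-∑ anything ⟨
    count anything                              ≤⟨ count-mono anything leafOrCentre (λ x _ → covers x) ⟩
    count leafOrCentre                          ≡⟨ count-∨ _ _ disjoint ⟩
    leafCount T c + count (λ x → does (c ≟ x))  ≡⟨ cong (leafCount T c +_) (count-≟ c) ⟩
    leafCount T c + 1                           ∎)
    where
    open ≤-Reasoning
    anything leafOrCentre : Fin (suc m) → Bool
    anything x = true
    leafOrCentre x = isLeafAt T c x ∨ does (c ≟ x)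
    disjoint : ∀ x → isLeafAt T c x ≡ true → does (c ≟ x) ≢ true
    disjoint x cx c≡x = Adj⇒≢ T (leaf-adj T cx) (does-true⁻ (c ≟ x) c≡x)
    covers : ∀ x → leafOrCentre x ≡ true
    covers x with c ≟ x
    ... | yes _   = ∨-zeroʳ _
    ... | no  c≢x = cong (_∨ false) (leaf-at-centre x (c≢x ∘ sym))

  closedSum-leaf : ∀ f {x} → x ≢ c → closedSum T f x ≡ f x + f c
  closedSum-leaf f {x} x≢c = begin
    closedSum T f x                                 ≡⟨ closedSum-∑ T f x ⟩
    ∑ (λ y → if inN T x y then f y else 0)          ≡⟨ sum-cong-≗ split ⟩
    ∑ (λ y → δ x y + δ c y)                         ≡⟨ ∑-distrib-+ (δ x) (δ c) ⟩
    ∑ (δ x) + ∑ (δ c)                               ≡⟨ cong₂ _+_ (∑-δ x (f x)) (∑-δ c (f c)) ⟩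
    f x + f c                                       ∎
    where
    open ≡-Reasoning
    δ : Fin (suc m) → Fin (suc m) → ℕ
    δ z y = if does (z ≟ y) then f z else 0
    split : ∀ y → (if inN T x y then f y else 0) ≡ δ x y + δ c y
    split y rewrite adj-leaf x≢c y with x ≟ y | c ≟ y
    ... | yes refl | yes refl = contradiction refl x≢c
    ... | yes refl | no _     = sym (+-identityʳ _)
    ... | no _     | yes refl = refl
    ... | no _     | no _     = refl

  -- The sums at the vertices other than `c` share the summand `f c`, and their closed
  -- neighbourhoods are pairwise different, so `f` is injective on these m vertices.
  m≤label-bound : ∀ j → Admits T j → m ≤ j
  m≤label-bound j (f , bounds , distinct) = Fin.injective⇒≤ {f = label} λ {a} {b} e →
    Fin.punchIn-injective c a b (leaf-injective (Fin.punchInᵢ≢i c a) (Fin.punchInᵢ≢i c b)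
      (∸-cancelʳ-≡ (proj₁ (bounds _)) (proj₁ (bounds _)) (Fin.fromℕ<-injective _ _ _ _ e)))
    where
    leaf-injective : ∀ {x y} → x ≢ c → y ≢ c → f x ≡ f y → x ≡ y
    leaf-injective {x} {y} x≢c y≢c fx≡fy = decidable-stable (x ≟ y) λ x≢y →
      distinct x y
        (λ same → true≢false (trans (sym (inN-refl T x)) (trans (same x)
          (cong₂ _∨_ (dec-false (y ≟ x) (x≢y ∘ sym)) (independent y x y≢c x≢c)))))
        (trans (closedSum-leaf f x≢c) (trans (cong (_+ f c) fx≡fy) (sym (closedSum-leaf f y≢c))))
    pred-< : ∀ {a} → 1 ≤ a → a ≤ j → a ∸ 1 < j
    pred-< 1≤a a≤j = ≤-trans (≤-reflexive (m+[n∸m]≡n 1≤a)) a≤j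
    -- `punchIn c` enumerates the vertices other than `c`; labels from 1 to j are lowered by one to
    -- land in `Fin j`.
    label : Fin m → Fin j
    label i = fromℕ< (pred-< (proj₁ (bounds (punchIn c i))) (proj₂ (bounds (punchIn c i))))

-- The bound for trees and its sharpness for stars

theorem4 : ∀ (n : ℕ) (T : Graph n) → 3 ≤ n → IsTree T →
    Admits T (2 * n ∸ 2 ∸ maxLeaves T)
    × (IsStar T → IsSStar T (2 * n ∸ 2 ∸ maxLeaves T))
theorem4 n@(suc m) T 3≤n (connected , acyclic) = admitted , λ (c , centre , independent) →
    admitted , λ j adm →
      ≤-trans (star-bound c centre independent) (Star.m≤label-bound T c centre independent j adm)
  where
  k = 2 * n ∸ 2 ∸ maxLeaves T
  attained = max-attained (leafCount T) Fin.zero (allFin n)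
  u = proj₁ attained
  room : 2 * n ≤ k + (2 + leafCount T u)
  room = begin
    -- This inequality holds for truncated subtraction without first checking 2 + M ≤ 2n.
    2 * n                            ≤⟨ m≤n+m∸n (2 * n) (2 + M) ⟩
    (2 + M) + (2 * n ∸ (2 + M))      ≡⟨ cong (2 + M +_) (∸-+-assoc (2 * n) 2 M) ⟨
    (2 + M) + k                      ≡⟨ +-comm (2 + M) k ⟩
    k + (2 + M)                      ≤⟨ +-monoʳ-≤ k (+-monoʳ-≤ 2 (proj₂ attained)) ⟩
    k + (2 + leafCount T u)          ∎
    where
    open ≤-Reasoning
    M = maxLeaves T
  admitted : Admits T k
  admitted = Greedy.admits T 3≤n connected acyclic u k room
  -- With n = m + 1 and at least m leaves at the centre, k is at most 2m - m.
  star-bound : ∀ c → (∀ x → x ≢ c → Adj T c x) →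
    (∀ x y → x ≢ c → y ≢ c → adj T x y ≡ false) → k ≤ m
  star-bound c centre independent = begin
    2 * n ∸ 2 ∸ maxLeaves T  ≤⟨ ∸-monoʳ-≤ (2 * n ∸ 2) (≤-trans (Star.m≤leafCount T c centre independent)
                                  (≤-max (leafCount T) (∈-allFin c))) ⟩
    2 * n ∸ 2 ∸ m            ≡⟨ cong (λ z → z ∸ 1 ∸ m) (+-suc m (m + 0)) ⟩
    m + (m + 0) ∸ m          ≡⟨ cong (λ z → m + z ∸ m) (+-identityʳ m) ⟩
    m + m ∸ m                ≡⟨ m+n∸n≡m m m ⟩
    m                        ∎
    where open ≤-Reasoning
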